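{- Let $k$ be a positive integer and let $G$ be a connected $k$-regular graph of order $n$. \begin{enumerate} \item If $k$ is odd, then $G$ admits a $1$-sum $\{ -1,0,1\}$-flow. \item If $k\equiv2\pmod 4$ and $n$ is even, then $G$ admits a $1$-sum $\{ -1,0,1\}$-flow. \end{enumerate}
   Context: For a graph $G=(V,E)$ and $L\subseteq\mathbb{R}$, a $1$-sum $L$-flow is a function $\omega:E\to L$ such that $\sum_{e\ni v}\omega(e)=1$ for every vertex $v$. -}

module Defs where

open import Data.Nat using (ℕ; zero; suc)
open import Data.Integer using (ℤ; +_; -[1+_]; _+_)
open import Data.Fin using (Fin)
open import Data.List using (List; []; _∷_; filter; length; map; foldr; allFin)
open import Data.Product using (_×_; Σ; ∃)
open import Data.Sum using (_⊎_)
open import Relation.Nullary using (¬_; Dec)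
open import Relation.Unary using (Decidable)
open import Relation.Binary.PropositionalEquality using (_≡_)

record Graph (n : ℕ) : Set₁ where
  field
    Adj   : Fin n → Fin n → Set
    adj?  : (u v : Fin n) → Dec (Adj u v)
    sym   : ∀ {u v} → Adj u v → Adj v u
    irrefl : ∀ {u} → ¬ Adj u u

open Graph public

neighbours : ∀ {n} (G : Graph n) → Fin n → List (Fin n)
neighbours G v = filter (λ u → adj? G v u) (allFin _)

degree : ∀ {n} (G : Graph n) → Fin n → ℕ
degree G v = length (neighbours G v)

Regular : ∀ {n} → ℕ → Graph n → Set
Regular k G = ∀ v → degree G v ≡ k

data Walk {n} (G : Graph n) : Fin n → Fin n → Set where
  here : ∀ {u} → Walk G u u
  step : ∀ {u w v} → Adj G u w → Walk G w v → Walk G u v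

Connected : ∀ {n} → Graph n → Set
Connected G = ∀ u v → Walk G u v

InL : ℤ → Set
InL x = (x ≡ -[1+ 0 ]) ⊎ (x ≡ + 0) ⊎ (x ≡ + 1)

sumℤ : List ℤ → ℤ
sumℤ = foldr _+_ (+ 0)

-- An edge function: weight ω u v on the edge uv (symmetric, so each
-- undirected edge carries a single value).  Values on non-edges are irrelevant.
-- A 1-sum {-1,0,1}-flow: every edge value lies in {-1,0,1} and the sum over
-- edges incident to each vertex v equals 1.
record OneSumFlow {n} (G : Graph n) : Set where
  field
    ω      : Fin n → Fin n → ℤ
    ω-sym  : ∀ u v → Adj G u v → ω u v ≡ ω v u
    ω-in   : ∀ u v → Adj G u v → InL (ω u v)
    sum-1  : ∀ v → sumℤ (map (ω v) (neighbours G v)) ≡ + 1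

-- If k = 2r + 1, the k-regular bipartite double cover of G has an r-regular
-- factor X, and 1 − X u v − X v u is a flow.  The factor is found by deciding
-- arcs one at a time, keeping Hoffman's cut condition by submodularity.
--
-- If k = 2j with j odd and n is even, then G is Eulerian with nj edges, an even
-- number.  Every other edge of an Euler tour forms a j-regular subgraph, to which
-- the first case applies.
module Submission where

open import Defs renaming (sym to adj-sym)
open import Data.Bool using (Bool; true; false; _∧_; _∨_; if_then_else_)
open import Data.Fin using (Fin; zero; suc)
import Data.Fin as Fin
import Data.Fin.Properties as Fin
open import Data.Fin.Subset using (Subset; _∩_; _∪_; ⁅_⁆) renaming (⊥ to ∅)
open import Data.Fin.Subset.Properties using (anySubset?)
open import Data.Integer using (ℤ; +_; -[1+_]; _+_; _*_; -_; _-_; 0ℤ; 1ℤ; +≤+; -≤+)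
import Data.Integer as ℤ
import Data.Integer.Properties as ℤ
open import Data.Integer.Tactic.RingSolver using (solve-∀)
open import Data.Nat.Tactic.RingSolver using () renaming (solve-∀ to ℕ-solve-∀)
open import Data.List using (List; []; _∷_; _++_; map; filter; length; tabulate; allFin; cartesianProduct)
import Data.List.Properties as List
open import Data.List.Membership.Propositional using (_∈_)
open import Data.List.Membership.Propositional.Properties using (∈-allFin; ∈-cartesianProduct⁺)
open import Data.List.Relation.Unary.Any using (here; there)
open import Data.Nat using (ℕ; zero; suc; _%_; _≤_)
import Data.Nat as ℕ
import Data.Nat.Properties as ℕ
import Data.Nat.DivMod as ℕ
open import Data.Product using (_×_; _,_; ∃; ∃-syntax; uncurry)
open import Data.Sum using (_⊎_; inj₁; inj₂)
open import Data.Vec using (lookup)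
import Data.Vec.Properties as Vec
open import Function using (_∘_)
open import Relation.Binary using (tri<; tri≈; tri>)
open import Relation.Binary.PropositionalEquality
  using (_≡_; _≢_; refl; sym; trans; cong; cong₂; subst; module ≡-Reasoning)
open import Relation.Nullary using (Dec; yes; no; does; contradiction; _×-dec_; map′)
open import Relation.Nullary.Decidable using (dec-true; dec-false; from-yes)
open import Relation.Unary using (Decidable)
open import Algebra.Properties.Semiring.Sum ℤ.+-*-semiring
  using (sum; ∑-comm; ∑-distrib-+; sum-cong-≗; *-distribˡ-sum; sum-syntax)

-- A regular graph need not contain a spanning `r`-regular subgraph: a cubic graph with bridges may
-- have no perfect matching. Hence edges are not selected directly. In the double cover an edge
-- becomes two arcs that are chosen independently; choosing 0, 1 or 2 of them gives the edge weight
-- 1, 0 or -1. At each vertex `r` arcs leave and `r` enter, so the weights add up to (2r + 1) - r -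
-- r = 1.
--
-- The parity of nj enters at a single vertex, the base of the Euler tour. A tour of odd length
-- begins and ends with a selected arc, which would give the base degree j + 1 instead of j.

private
  variable
    n : ℕ

-- Indicators and finite integer sums

𝟙 : Bool → ℤ
𝟙 true  = 1ℤ
𝟙 false = 0ℤ

δ : Fin n → Fin n → ℤ
δ zero    zero    = 1ℤ
δ zero    (suc _) = 0ℤ
δ (suc _) zero    = 0ℤ
δ (suc x) (suc y) = δ x y

δ-refl : (x : Fin n) → δ x x ≡ 1ℤ
δ-refl zero    = refl
δ-refl (suc x) = δ-refl x

δ-≢ : {x y : Fin n} → x ≢ y → δ x y ≡ 0ℤ
δ-≢ {x = zero}  {zero}  x≢y = contradiction refl x≢y
δ-≢ {x = zero}  {suc y} x≢y = refl
δ-≢ {x = suc x} {zero}  x≢y = refl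
δ-≢ {x = suc x} {suc y} x≢y = δ-≢ (x≢y ∘ cong suc)

δ-sym : (x y : Fin n) → δ x y ≡ δ y x
δ-sym zero    zero    = refl
δ-sym zero    (suc y) = refl
δ-sym (suc x) zero    = refl
δ-sym (suc x) (suc y) = δ-sym x y

0≤δ : (x y : Fin n) → 0ℤ ℤ.≤ δ x y
0≤δ zero    zero    = +≤+ ℕ.z≤n
0≤δ zero    (suc y) = +≤+ ℕ.z≤n
0≤δ (suc x) zero    = +≤+ ℕ.z≤n
0≤δ (suc x) (suc y) = 0≤δ x y

*-nonneg : ∀ {i j} → 0ℤ ℤ.≤ i → 0ℤ ℤ.≤ j → 0ℤ ℤ.≤ i * j
*-nonneg {i} {j} 0≤i 0≤j =
  subst (ℤ._≤ i * j) (ℤ.*-zeroʳ i) (ℤ.*-monoˡ-≤-nonNeg i {{ℤ.nonNegative 0≤i}} 0≤j)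

0≤δδ : (x y u v : Fin n) → 0ℤ ℤ.≤ δ x y * δ u v
0≤δδ x y u v = *-nonneg (0≤δ x y) (0≤δ u v)

sum-const : ∀ n c → sum {n} (λ _ → c) ≡ + n * c
sum-const zero    c = sym (ℤ.*-zeroˡ c)
sum-const (suc n) c = begin
  c + sum {n} (λ _ → c)   ≡⟨ cong₂ _+_ (refl {x = c}) (sum-const n c) ⟩
  c + + n * c             ≡⟨ regroup c (+ n) ⟩
  (1ℤ + + n) * c          ∎
  where
  open ≡-Reasoning
  regroup : ∀ c m → c + m * c ≡ (1ℤ + m) * c
  regroup = solve-∀

sum-zero : (f : Fin n → ℤ) → (∀ x → f x ≡ 0ℤ) → sum f ≡ 0ℤ
sum-zero {n} f f≡0 = trans (sum-cong-≗ f≡0) (trans (sum-const n 0ℤ) (ℤ.*-zeroʳ (+ n)))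

sum-δ : (u : Fin n) (f : Fin n → ℤ) → ∑[ x < n ] (δ u x * f x) ≡ f u
sum-δ zero f = trans (cong₂ _+_ (ℤ.*-identityˡ (f zero)) (sum-zero (λ x → 0ℤ * f (suc x)) (λ x → ℤ.*-zeroˡ (f (suc x))))) (ℤ.+-identityʳ _)
sum-δ (suc u) f = trans (cong₂ _+_ (ℤ.*-zeroˡ (f zero)) (sum-δ u (f ∘ suc))) (ℤ.+-identityˡ _)

sum-δ₁ : (u : Fin n) → sum (δ u) ≡ 1ℤ
sum-δ₁ u = trans (sum-cong-≗ (λ x → sym (ℤ.*-identityʳ (δ u x)))) (sum-δ u (λ _ → 1ℤ))

sum-mono : {f g : Fin n → ℤ} → (∀ x → f x ℤ.≤ g x) → sum f ℤ.≤ sum g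
sum-mono {zero}  f≤g = ℤ.≤-refl
sum-mono {suc n} f≤g = ℤ.+-mono-≤ (f≤g zero) (sum-mono (f≤g ∘ suc))

sum-neg : (f : Fin n → ℤ) → sum (λ x → - f x) ≡ - sum f
sum-neg {zero}  f = refl
sum-neg {suc n} f =
  trans (cong₂ _+_ (refl {x = - f zero}) (sum-neg (f ∘ suc))) (sym (ℤ.neg-distrib-+ (f zero) (sum (f ∘ suc))))

sum-sub : (f g : Fin n → ℤ) → sum (λ x → f x - g x) ≡ sum f - sum g
sum-sub f g = trans (∑-distrib-+ f (λ x → - g x)) (cong (λ s → sum f + s) (sum-neg g))

-- An excess of `f` over `g` at one place could not be compensated at another. This later turns
-- bounds on row and column sums into equalities.
sum-≤⇒≗ : {f g : Fin n → ℤ} → (∀ x → g x ℤ.≤ f x) → sum f ℤ.≤ sum g → ∀ x → f x ≡ g x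
sum-≤⇒≗ {suc n} {f} {g} g≤f Σf≤Σg = λ where
    zero    → head≡
    (suc x) → sum-≤⇒≗ (g≤f ∘ suc) tail≤ x
  where
  F = sum (f ∘ suc)
  G = sum (g ∘ suc)
  cancel : ∀ a b → a + b - b ≡ a
  cancel = solve-∀
  cancelˡ : ∀ a b → (- a) + (a + b) ≡ b
  cancelˡ = solve-∀
  head≡ : f zero ≡ g zero
  head≡ = ℤ.≤-antisym
    (subst (λ z → z ℤ.≤ g zero) (cancel (f zero) G)
      (subst (f zero + G - G ℤ.≤_) (cancel (g zero) G)
        (ℤ.+-monoˡ-≤ (- G) (ℤ.≤-trans (ℤ.+-monoʳ-≤ (f zero) (sum-mono (g≤f ∘ suc))) Σf≤Σg))))
    (g≤f zero)
  tail≤ : F ℤ.≤ G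
  tail≤ = subst (λ z → z ℤ.≤ G) (cancelˡ (g zero) F)
    (subst (- g zero + (g zero + F) ℤ.≤_) (cancelˡ (g zero) G)
      (ℤ.+-monoʳ-≤ (- g zero) (ℤ.≤-trans (ℤ.+-monoˡ-≤ F (g≤f zero)) Σf≤Σg)))

-- Regular factors of bipartite graphs

data Cell : Set where
  out inn free : Cell

-- The most a cell can contribute to X(S, Tᶜ) − X(Sᶜ, T), where s and t say
-- whether its row lies in S and its column in T.
φ : Cell → Bool → Bool → ℤ
φ out  _     _     = 0ℤ
φ inn  true  false = 1ℤ
φ inn  false true  = -[1+ 0 ]
φ inn  _     _     = 0ℤ
φ free true  false = 1ℤ
φ free _     _     = 0ℤ

all? : {P : Bool → Set} → (∀ b → Dec (P b)) → Dec (∀ b → P b)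
all? P? = map′ (λ { (t , f) → λ { true → t ; false → f } }) (λ p → p true , p false) (P? true ×-dec P? false)

≤₄? : (f g : Bool → Bool → Bool → Bool → ℤ) → Dec (∀ a b c d → f a b c d ℤ.≤ g a b c d)
≤₄? f g = all? λ a → all? λ b → all? λ c → all? λ d → f a b c d ℤ.≤? g a b c d

-- A decided cell contributes 0 or `𝟙 s - 𝟙 t`, which are modular; a free cell contributes the cut
-- function of an arc, which is submodular. The cases are evaluated.
φ-submodular : ∀ c s₁ t₁ s₂ t₂ →
  φ c (s₁ ∧ s₂) (t₁ ∧ t₂) + φ c (s₁ ∨ s₂) (t₁ ∨ t₂) ℤ.≤ φ c s₁ t₁ + φ c s₂ t₂
φ-submodular c = by-cases c
  where
  meet+join : Cell → Bool → Bool → Bool → Bool → ℤ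
  meet+join c s₁ t₁ s₂ t₂ = φ c (s₁ ∧ s₂) (t₁ ∧ t₂) + φ c (s₁ ∨ s₂) (t₁ ∨ t₂)
  both : Cell → Bool → Bool → Bool → Bool → ℤ
  both c s₁ t₁ s₂ t₂ = φ c s₁ t₁ + φ c s₂ t₂
  by-cases : ∀ c s₁ t₁ s₂ t₂ → meet+join c s₁ t₁ s₂ t₂ ℤ.≤ both c s₁ t₁ s₂ t₂
  by-cases out  = from-yes (≤₄? (meet+join out) (both out))
  by-cases inn  = from-yes (≤₄? (meet+join inn) (both inn))
  by-cases free = from-yes (≤₄? (meet+join free) (both free))

-- The unit is the whole price of deciding a cell in two different ways. If `φ inn s₂ t₂` is -1,
-- both terms on the left vanish; if it is 0, at most one of them is 1; if it is 1, the right side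
-- is 2.
φ-branch : ∀ s₁ t₁ s₂ t₂ →
  φ free (s₁ ∧ s₂) (t₁ ∧ t₂) + φ free (s₁ ∨ s₂) (t₁ ∨ t₂) ℤ.≤ φ out s₁ t₁ + φ inn s₂ t₂ + 1ℤ
φ-branch = from-yes (≤₄?
  (λ s₁ t₁ s₂ t₂ → φ free (s₁ ∧ s₂) (t₁ ∧ t₂) + φ free (s₁ ∨ s₂) (t₁ ∨ t₂))
  (λ s₁ t₁ s₂ t₂ → φ out s₁ t₁ + φ inn s₂ t₂ + 1ℤ))

∑∑ : (Fin n → Fin n → ℤ) → ℤ
∑∑ f = sum (λ x → sum (f x))

∑∑-+ : (f g : Fin n → Fin n → ℤ) → ∑∑ (λ x y → f x y + g x y) ≡ ∑∑ f + ∑∑ g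
∑∑-+ f g = trans (sum-cong-≗ (λ x → ∑-distrib-+ (f x) (g x)))
                 (∑-distrib-+ (λ x → sum (f x)) (λ x → sum (g x)))

∑∑-cong : {f g : Fin n → Fin n → ℤ} → (∀ x y → f x y ≡ g x y) → ∑∑ f ≡ ∑∑ g
∑∑-cong f≡g = sum-cong-≗ (λ x → sum-cong-≗ (f≡g x))

∑∑-mono : {f g : Fin n → Fin n → ℤ} → (∀ x y → f x y ℤ.≤ g x y) → ∑∑ f ℤ.≤ ∑∑ g
∑∑-mono f≤g = sum-mono (λ x → sum-mono (f≤g x))

∑∑-δ : (i j : Fin n) (f : Fin n → Fin n → ℤ) → ∑∑ (λ x y → δ i x * δ j y * f x y) ≡ f i j
∑∑-δ i j f = begin
  ∑∑ (λ x y → δ i x * δ j y * f x y)    ≡⟨ ∑∑-cong (λ x y → ℤ.*-assoc (δ i x) (δ j y) (f x y)) ⟩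
  ∑∑ (λ x y → δ i x * (δ j y * f x y))
    ≡⟨ sum-cong-≗ (λ x → *-distribˡ-sum (δ i x) (λ y → δ j y * f x y)) ⟨
  sum (λ x → δ i x * sum (λ y → δ j y * f x y)) ≡⟨ sum-δ i (λ x → sum (λ y → δ j y * f x y)) ⟩
  sum (λ y → δ j y * f i y)             ≡⟨ sum-δ j (f i) ⟩
  f i j                                 ∎
  where open ≡-Reasoning

-- Rows are one side of the bipartite graph and columns the other; in the application both are
-- copies of the vertex set.
Cells : ℕ → Set
Cells n = Fin n → Fin n → Cell

crossing : Cells n → (S T : Fin n → Bool) → ℤ
crossing M S T = ∑∑ (λ x y → φ (M x y) (S x) (T y))

size : (Fin n → Bool) → ℤ
size S = sum (λ x → 𝟙 (S x))

-- A factor X with all row and column sums r satisfies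
-- X(S, Tᶜ) − X(Sᶜ, T) = r(|S| − |T|), so every slack must be nonnegative.
slack : ℤ → Cells n → (S T : Fin n → Bool) → ℤ
slack r M S T = crossing M S T - r * size S + r * size T

-- Cuts range over bit vectors rather than predicates, so that a finite search decides the condition
-- and returns a violated cut when it fails.
Feasible : ℤ → Cells n → Set
Feasible r M = ∀ S T → 0ℤ ℤ.≤ slack r M (lookup S) (lookup T)

size-∩∪ : (S T : Subset n) →
  size (lookup (S ∩ T)) + size (lookup (S ∪ T)) ≡ size (lookup S) + size (lookup T)
size-∩∪ S T = begin
  size (lookup (S ∩ T)) + size (lookup (S ∪ T))
    ≡⟨ ∑-distrib-+ (𝟙 ∘ lookup (S ∩ T)) (𝟙 ∘ lookup (S ∪ T)) ⟨
  sum (λ x → 𝟙 (lookup (S ∩ T) x) + 𝟙 (lookup (S ∪ T) x))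
    ≡⟨ sum-cong-≗ (λ x → trans
         (cong₂ (λ s t → 𝟙 s + 𝟙 t) (Vec.lookup-zipWith _∧_ x S T) (Vec.lookup-zipWith _∨_ x S T))
         (modular (lookup S x) (lookup T x))) ⟩
  sum (λ x → 𝟙 (lookup S x) + 𝟙 (lookup T x))
    ≡⟨ ∑-distrib-+ (𝟙 ∘ lookup S) (𝟙 ∘ lookup T) ⟩
  size (lookup S) + size (lookup T) ∎
  where
  open ≡-Reasoning
  modular : ∀ s t → 𝟙 (s ∧ t) + 𝟙 (s ∨ t) ≡ 𝟙 s + 𝟙 t
  modular true  true  = refl
  modular true  false = refl
  modular false true  = refl
  modular false false = refl

update : Cells n → Fin n → Fin n → Cell → Cells n
update M i j c x y = if does (x Fin.≟ i) ∧ does (y Fin.≟ j) then c else M x y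

update-≡ : (M : Cells n) (i j : Fin n) (c : Cell) → update M i j c i j ≡ c
update-≡ M i j c rewrite dec-true (i Fin.≟ i) refl | dec-true (j Fin.≟ j) refl = refl

update-≢free : (M : Cells n) (i j : Fin n) (c : Cell) → M i j ≡ free →
  ∀ x y → M x y ≢ free → update M i j c x y ≡ M x y
update-≢free M i j c Mij≡free x y Mxy≢free with x Fin.≟ i | y Fin.≟ j
... | yes refl | yes refl = contradiction Mij≡free Mxy≢free
... | yes _    | no _     = refl
... | no _     | _        = refl

crossing-branch : (M : Cells n) (i j : Fin n) → M i j ≡ free → (S₁ T₁ S₂ T₂ : Subset n) →
  crossing M (lookup (S₁ ∩ S₂)) (lookup (T₁ ∩ T₂)) + crossing M (lookup (S₁ ∪ S₂)) (lookup (T₁ ∪ T₂))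
  ℤ.≤ crossing (update M i j out) (lookup S₁) (lookup T₁)
    + crossing (update M i j inn) (lookup S₂) (lookup T₂) + 1ℤ
crossing-branch M i j Mij≡free S₁ T₁ S₂ T₂ = begin
  ∑∑ meet + ∑∑ join                     ≡⟨ ∑∑-+ meet join ⟨
  ∑∑ (λ x y → meet x y + join x y)      ≤⟨ ∑∑-mono entry ⟩
  -- The product of deltas charges the unit from `φ-branch` to the cell `(i , j)` alone, so over the
  -- whole table it adds up to 1.
  ∑∑ (λ x y → left x y + right x y + δ i x * δ j y * 1ℤ)
    ≡⟨ ∑∑-+ (λ x y → left x y + right x y) (λ x y → δ i x * δ j y * 1ℤ) ⟩
  ∑∑ (λ x y → left x y + right x y) + ∑∑ (λ x y → δ i x * δ j y * 1ℤ)
    ≡⟨ cong₂ _+_ (∑∑-+ left right) (∑∑-δ i j (λ _ _ → 1ℤ)) ⟩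
  ∑∑ left + ∑∑ right + 1ℤ               ∎
  where
  open ℤ.≤-Reasoning
  meet join left right : Fin _ → Fin _ → ℤ
  meet x y = φ (M x y) (lookup (S₁ ∩ S₂) x) (lookup (T₁ ∩ T₂) y)
  join x y = φ (M x y) (lookup (S₁ ∪ S₂) x) (lookup (T₁ ∪ T₂) y)
  left x y = φ (update M i j out x y) (lookup S₁ x) (lookup T₁ y)
  right x y = φ (update M i j inn x y) (lookup S₂ x) (lookup T₂ y)
  elsewhere : ∀ {x y} c → φ c (lookup S₁ x ∧ lookup S₂ x) (lookup T₁ y ∧ lookup T₂ y)
                        + φ c (lookup S₁ x ∨ lookup S₂ x) (lookup T₁ y ∨ lookup T₂ y)
    ℤ.≤ φ c (lookup S₁ x) (lookup T₁ y) + φ c (lookup S₂ x) (lookup T₂ y) + δ i x * δ j y * 1ℤ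
  elsewhere {x} {y} c = ℤ.≤-trans
    (φ-submodular c (lookup S₁ x) (lookup T₁ y) (lookup S₂ x) (lookup T₂ y))
    (subst (ℤ._≤ both + δ i x * δ j y * 1ℤ) (ℤ.+-identityʳ both)
      (ℤ.+-monoʳ-≤ both (*-nonneg (0≤δδ i x j y) (+≤+ ℕ.z≤n))))
    where both = φ c (lookup S₁ x) (lookup T₁ y) + φ c (lookup S₂ x) (lookup T₂ y)
  entry : ∀ x y → meet x y + join x y ℤ.≤ left x y + right x y + δ i x * δ j y * 1ℤ
  entry x y
    rewrite Vec.lookup-zipWith _∧_ x S₁ S₂ | Vec.lookup-zipWith _∧_ y T₁ T₂
          | Vec.lookup-zipWith _∨_ x S₁ S₂ | Vec.lookup-zipWith _∨_ y T₁ T₂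
    with x Fin.≟ i | y Fin.≟ j
  ... | yes refl | yes refl rewrite Mij≡free | δ-refl x | δ-refl y =
    φ-branch (lookup S₁ x) (lookup T₁ y) (lookup S₂ x) (lookup T₂ y)
  ... | yes _    | no _     = elsewhere (M x y)
  ... | no _     | _        = elsewhere (M x y)

-- Two violated cuts, one for each decision of a free cell, would uncross to two
-- feasible cuts of total slack at most (−1) + (−1) + 1.
slack-branch : ∀ r (M : Cells n) (i j : Fin n) → M i j ≡ free → (S₁ T₁ S₂ T₂ : Subset n) →
  slack r M (lookup (S₁ ∩ S₂)) (lookup (T₁ ∩ T₂)) + slack r M (lookup (S₁ ∪ S₂)) (lookup (T₁ ∪ T₂))
  ℤ.≤ slack r (update M i j out) (lookup S₁) (lookup T₁)
    + slack r (update M i j inn) (lookup S₂) (lookup T₂) + 1ℤ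
slack-branch r M i j Mij≡free S₁ T₁ S₂ T₂ = begin
  c∩ - r * s∩ + r * t∩ + (c∪ - r * s∪ + r * t∪)
    ≡⟨ regroup c∩ c∪ s∩ s∪ t∩ t∪ r ⟩
  c∩ + c∪ + (r * (t∩ + t∪) - r * (s∩ + s∪))
    ≡⟨ cong₂ (λ s t → c∩ + c∪ + (r * t - r * s)) (size-∩∪ S₁ S₂) (size-∩∪ T₁ T₂) ⟩
  c∩ + c∪ + (r * (t₁ + t₂) - r * (s₁ + s₂))
    ≤⟨ ℤ.+-monoˡ-≤ _ (crossing-branch M i j Mij≡free S₁ T₁ S₂ T₂) ⟩
  c₁ + c₂ + 1ℤ + (r * (t₁ + t₂) - r * (s₁ + s₂))
    ≡⟨ regroup′ c₁ c₂ s₁ s₂ t₁ t₂ r ⟩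
  c₁ - r * s₁ + r * t₁ + (c₂ - r * s₂ + r * t₂) + 1ℤ ∎
  where
  open ℤ.≤-Reasoning
  c∩ = crossing M (lookup (S₁ ∩ S₂)) (lookup (T₁ ∩ T₂))
  c∪ = crossing M (lookup (S₁ ∪ S₂)) (lookup (T₁ ∪ T₂))
  c₁ = crossing (update M i j out) (lookup S₁) (lookup T₁)
  c₂ = crossing (update M i j inn) (lookup S₂) (lookup T₂)
  s∩ = size (lookup (S₁ ∩ S₂))
  s∪ = size (lookup (S₁ ∪ S₂))
  t∩ = size (lookup (T₁ ∩ T₂))
  t∪ = size (lookup (T₁ ∪ T₂))
  s₁ = size (lookup S₁)
  s₂ = size (lookup S₂)
  t₁ = size (lookup T₁)
  t₂ = size (lookup T₂)
  regroup : ∀ a b c d e f r → a - r * c + r * e + (b - r * d + r * f) ≡ a + b + (r * (e + f) - r * (c + d))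
  regroup = solve-∀
  regroup′ : ∀ a b c d e f r → a + b + 1ℤ + (r * (e + f) - r * (c + d)) ≡ a - r * c + r * e + (b - r * d + r * f) + 1ℤ
  regroup′ = solve-∀

feasible? : ∀ r (M : Cells n) → Feasible r M ⊎ ∃[ S ] ∃[ T ] slack r M (lookup S) (lookup T) ℤ.< 0ℤ
feasible? r M with anySubset? (λ S → anySubset? (λ T → slack r M (lookup S) (lookup T) ℤ.<? 0ℤ))
... | yes (S , T , neg) = inj₂ (S , T , neg)
... | no ¬neg           = inj₁ (λ S T → ℤ.≮⇒≥ (λ neg → ¬neg (S , T , neg)))

decide-cell : ∀ r (M : Cells n) → Feasible r M → ∀ i j → M i j ≡ free →
  Feasible r (update M i j out) ⊎ Feasible r (update M i j inn)
decide-cell r M feasible i j Mij≡free with feasible? r (update M i j out) | feasible? r (update M i j inn)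
... | inj₁ ok | _       = inj₁ ok
... | inj₂ _  | inj₁ ok = inj₂ ok
... | inj₂ (S₁ , T₁ , neg₁) | inj₂ (S₂ , T₂ , neg₂) = contradiction
  (ℤ.≤-trans
    (ℤ.+-mono-≤ (feasible (S₁ ∩ S₂) (T₁ ∩ T₂)) (feasible (S₁ ∪ S₂) (T₁ ∪ T₂)))
    (ℤ.≤-trans (slack-branch r M i j Mij≡free S₁ T₁ S₂ T₂)
      (ℤ.+-monoˡ-≤ 1ℤ (ℤ.+-mono-≤ (ℤ.i<j⇒i≤pred[j] neg₁) (ℤ.i<j⇒i≤pred[j] neg₂)))))
  λ ()

-- That decided cells keep their value is needed twice: a cell settled earlier in the list stays
-- settled, and a cell outside the bipartite graph stays `out`.
decide-cells : ∀ r (L : List (Fin n × Fin n)) (M : Cells n) → Feasible r M →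
  ∃[ M′ ] Feasible r M′ × (∀ x y → M x y ≢ free → M′ x y ≡ M x y)
                        × (∀ x y → (x , y) ∈ L → M′ x y ≢ free)
decide-cells r [] M feasible = M , feasible , (λ _ _ _ → refl) , λ _ _ ()
decide-cells {n} r ((i , j) ∷ L) M feasible = settle (free? (M i j))
  where
  free? : ∀ c → Dec (c ≡ free)
  free? out  = no λ ()
  free? inn  = no λ ()
  free? free = yes refl
  Result = ∃[ M′ ] Feasible r M′ × (∀ x y → M x y ≢ free → M′ x y ≡ M x y)
                 × (∀ x y → (x , y) ∈ (i , j) ∷ L → M′ x y ≢ free)
  continue : (M₁ : Cells n) → Feasible r M₁ → (∀ x y → M x y ≢ free → M₁ x y ≡ M x y) →
    M₁ i j ≢ free → Result
  continue M₁ feasible₁ keeps₁ decided₁ with decide-cells r L M₁ feasible₁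
  ... | M′ , feasible′ , keeps′ , decided′ = M′ , feasible′
    , (λ x y Mxy → trans (keeps′ x y (λ M₁xy → Mxy (trans (sym (keeps₁ x y Mxy)) M₁xy))) (keeps₁ x y Mxy))
    , λ where
        x y (here refl)  M′xy → decided₁ (trans (sym (keeps′ x y decided₁)) M′xy)
        x y (there xy∈L) M′xy → decided′ x y xy∈L M′xy
  assign : ∀ c → c ≢ free → M i j ≡ free → Feasible r (update M i j c) → Result
  assign c c≢free Mij≡free ok = continue (update M i j c) ok (update-≢free M i j c Mij≡free)
    (λ eq → c≢free (trans (sym (update-≡ M i j c)) eq))
  settle : Dec (M i j ≡ free) → Result
  settle (no Mij≢free)  = continue M feasible (λ _ _ _ → refl) Mij≢free
  settle (yes Mij≡free) with decide-cell r M feasible i j Mij≡free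
  ... | inj₁ ok = assign out (λ ()) Mij≡free ok
  ... | inj₂ ok = assign inn (λ ()) Mij≡free ok

-- For a 0-1 matrix `W` and indicators `f` of S and `g` of T, the entries in S × T cancel, so both
-- sides are the net count W(S, Tᶜ) - W(Sᶜ, T).
∑∑-marginals : (W : Fin n → Fin n → ℤ) (f g : Fin n → ℤ) →
  ∑∑ (λ x y → f x * W x y - g y * W x y)
  ≡ sum (λ x → f x * sum (λ y → W x y)) - sum (λ y → g y * sum (λ x → W x y))
∑∑-marginals W f g = begin
  ∑∑ (λ x y → f x * W x y - g y * W x y)
    ≡⟨ sum-cong-≗ (λ x → sum-sub (λ y → f x * W x y) (λ y → g y * W x y)) ⟩
  sum (λ x → sum (λ y → f x * W x y) - sum (λ y → g y * W x y))
    ≡⟨ sum-sub (λ x → sum (λ y → f x * W x y)) (λ x → sum (λ y → g y * W x y)) ⟩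
  ∑∑ (λ x y → f x * W x y) - ∑∑ (λ x y → g y * W x y)
    ≡⟨ cong (λ s → ∑∑ (λ x y → f x * W x y) - s) (∑-comm (λ x y → g y * W x y)) ⟩
  ∑∑ (λ x y → f x * W x y) - ∑∑ (λ y x → g y * W x y)
    ≡⟨ cong₂ _-_ (sum-cong-≗ (λ x → *-distribˡ-sum (f x) (λ y → W x y)))
                 (sum-cong-≗ (λ y → *-distribˡ-sum (g y) (λ x → W x y))) ⟨
  sum (λ x → f x * sum (λ y → W x y)) - sum (λ y → g y * sum (λ x → W x y)) ∎
  where open ≡-Reasoning

candidates : (Fin n → Fin n → Bool) → Cells n
candidates A x y = if A x y then free else out

-- With every arc free, the crossing number counts the arcs from S to Tᶜ. It is at least 0 and, by
-- regularity, at least k(|S| - |T|). Since 0 ≤ r ≤ k, one of the two bounds gives r(|S| - |T|),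
-- according to the sign of |S| - |T|.
candidates-feasible : ∀ {r k} (A : Fin n → Fin n → Bool) → 0ℤ ℤ.≤ r → r ℤ.≤ k →
  (∀ x → sum (λ y → 𝟙 (A x y)) ≡ k) → (∀ y → sum (λ x → 𝟙 (A x y)) ≡ k) →
  Feasible r (candidates A)
candidates-feasible {n} {r} {k} A 0≤r r≤k rows cols S T =
  subst (0ℤ ℤ.≤_) (regroup (crossing M S′ T′) r (size S′) (size T′)) (ℤ.i≤j⇒0≤j-i r*d≤c)
  where
  M = candidates A
  S′ = lookup S
  T′ = lookup T
  d = size S′ - size T′
  regroup : ∀ c r s t → c - r * (s - t) ≡ c - r * s + r * t
  regroup = solve-∀
  cell-nonneg : ∀ a s t → 0ℤ ℤ.≤ φ (if a then free else out) s t
  cell-nonneg true  true  true  = ℤ.≤-refl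
  cell-nonneg true  true  false = +≤+ ℕ.z≤n
  cell-nonneg true  false _     = ℤ.≤-refl
  cell-nonneg false _     _     = ℤ.≤-refl
  cell-net : ∀ a s t → 𝟙 s * 𝟙 a - 𝟙 t * 𝟙 a ℤ.≤ φ (if a then free else out) s t
  cell-net true  true  true  = ℤ.≤-refl
  cell-net true  true  false = ℤ.≤-refl
  cell-net true  false true  = -≤+
  cell-net true  false false = ℤ.≤-refl
  cell-net false true  true  = ℤ.≤-refl
  cell-net false true  false = ℤ.≤-refl
  cell-net false false true  = ℤ.≤-refl
  cell-net false false false = ℤ.≤-refl
  0≤c : 0ℤ ℤ.≤ crossing M S′ T′
  0≤c = subst (ℤ._≤ crossing M S′ T′) (sum-zero {n} (λ _ → sum {n} (λ _ → 0ℤ)) (λ _ → sum-zero {n} (λ _ → 0ℤ) (λ _ → refl)))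
    (∑∑-mono (λ x y → cell-nonneg (A x y) (S′ x) (T′ y)))
  scaled : ∀ (f g : Fin n → ℤ) → (∀ x → g x ≡ k) → sum (λ x → f x * g x) ≡ k * sum f
  scaled f g g≡k = trans (sum-cong-≗ (λ x → trans (cong (f x *_) (g≡k x)) (ℤ.*-comm (f x) k)))
                       (sym (*-distribˡ-sum k f))
  k*d≤c : k * d ℤ.≤ crossing M S′ T′
  k*d≤c = subst (ℤ._≤ crossing M S′ T′)
    (trans (∑∑-marginals (λ x y → 𝟙 (A x y)) (𝟙 ∘ S′) (𝟙 ∘ T′))
      (trans (cong₂ _-_ (scaled (𝟙 ∘ S′) (λ x → sum (λ y → 𝟙 (A x y))) rows)
                         (scaled (𝟙 ∘ T′) (λ y → sum (λ x → 𝟙 (A x y))) cols)) (factor-out k (size S′) (size T′))))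
    (∑∑-mono (λ x y → cell-net (A x y) (S′ x) (T′ y)))
    where
    factor-out : ∀ k s t → k * s - k * t ≡ k * (s - t)
    factor-out = solve-∀
  r*d≤c : r * d ℤ.≤ crossing M S′ T′
  r*d≤c with ℤ.≤-total 0ℤ d
  ... | inj₁ 0≤d = ℤ.≤-trans (ℤ.*-monoʳ-≤-nonNeg d {{ℤ.nonNegative 0≤d}} r≤k) k*d≤c
  ... | inj₂ d≤0 = ℤ.≤-trans
    (subst (r * d ℤ.≤_) (ℤ.*-zeroʳ r) (ℤ.*-monoˡ-≤-nonNeg r {{ℤ.nonNegative 0≤r}} d≤0)) 0≤c

isInn : Cell → Bool
isInn inn = true
isInn _   = false

𝟙-⁅⁆ : (i x : Fin n) → 𝟙 (lookup ⁅ i ⁆ x) ≡ δ i x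
𝟙-⁅⁆ zero    zero    = refl
𝟙-⁅⁆ zero    (suc x) = cong 𝟙 (Vec.lookup-replicate x false)
𝟙-⁅⁆ (suc i) zero    = refl
𝟙-⁅⁆ (suc i) (suc x) = 𝟙-⁅⁆ i x

𝟙-∅ : (x : Fin n) → 𝟙 (lookup (∅ {n}) x) ≡ 0ℤ
𝟙-∅ x = cong 𝟙 (Vec.lookup-replicate x false)

size-⁅⁆ : (i : Fin n) → size (lookup ⁅ i ⁆) ≡ 1ℤ
size-⁅⁆ i = trans (sum-cong-≗ (𝟙-⁅⁆ i)) (sum-δ₁ i)

size-∅ : size (lookup (∅ {n})) ≡ 0ℤ
size-∅ {n} = sum-zero (𝟙 ∘ lookup (∅ {n})) 𝟙-∅

-- Without free cells `φ` is exact, and one-element cuts suffice: ({i}, ∅) shows that row sums are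
-- at least `r`, and (∅, {j}) that column sums are at most `r`. Rows and columns have the same grand
-- total, so all these bounds are attained.
module Decided {n} (r : ℤ) (M : Cells n) (feasible : Feasible r M) (decided : ∀ x y → M x y ≢ free) where

  X : Fin n → Fin n → Bool
  X x y = isInn (M x y)

  row col : Fin n → ℤ
  row x = sum (λ y → 𝟙 (X x y))
  col y = sum (λ x → 𝟙 (X x y))

  cell-net : ∀ c s t → c ≢ free → φ c s t ≡ 𝟙 s * 𝟙 (isInn c) - 𝟙 t * 𝟙 (isInn c)
  cell-net out  true  true  _ = refl
  cell-net out  true  false _ = refl
  cell-net out  false true  _ = refl
  cell-net out  false false _ = refl
  cell-net inn  true  true  _ = refl
  cell-net inn  true  false _ = refl
  cell-net inn  false true  _ = refl
  cell-net inn  false false _ = refl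
  cell-net free _     _     d = contradiction refl d

  crossing-net : ∀ S T →
    crossing M S T ≡ sum (λ x → 𝟙 (S x) * row x) - sum (λ y → 𝟙 (T y) * col y)
  crossing-net S T = trans
    (∑∑-cong (λ x y → cell-net (M x y) (S x) (T y) (decided x y)))
    (∑∑-marginals (λ x y → 𝟙 (X x y)) (𝟙 ∘ S) (𝟙 ∘ T))

  over-⁅⁆ : ∀ i (f : Fin n → ℤ) → sum (λ x → 𝟙 (lookup ⁅ i ⁆ x) * f x) ≡ f i
  over-⁅⁆ i f = trans (sum-cong-≗ (λ x → cong (_* f x) (𝟙-⁅⁆ i x))) (sum-δ i f)

  over-∅ : ∀ (f : Fin n → ℤ) → sum (λ x → 𝟙 (lookup ∅ x) * f x) ≡ 0ℤ
  over-∅ f = sum-zero _ (λ x → trans (cong (_* f x) (𝟙-∅ x)) (ℤ.*-zeroˡ (f x)))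

  slack-net : ∀ S T → slack r M S T ≡
    sum (λ x → 𝟙 (S x) * row x) - sum (λ y → 𝟙 (T y) * col y) - r * size S + r * size T
  slack-net S T = cong (λ c → c - r * size S + r * size T) (crossing-net S T)

  r≤row : ∀ i → r ℤ.≤ row i
  r≤row i = ℤ.0≤i-j⇒j≤i (subst (0ℤ ℤ.≤_) eq (feasible ⁅ i ⁆ ∅))
    where
    simplify : ∀ a r → a - 0ℤ - r * 1ℤ + r * 0ℤ ≡ a - r
    simplify = solve-∀
    eq : slack r M (lookup ⁅ i ⁆) (lookup ∅) ≡ row i - r
    eq rewrite slack-net (lookup ⁅ i ⁆) (lookup ∅) | over-⁅⁆ i row | over-∅ col
             | size-⁅⁆ i | size-∅ {n} = simplify (row i) r

  col≤r : ∀ j → col j ℤ.≤ r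
  col≤r j = ℤ.0≤i-j⇒j≤i (subst (0ℤ ℤ.≤_) eq (feasible ∅ ⁅ j ⁆))
    where
    simplify : ∀ a r → 0ℤ - a - r * 0ℤ + r * 1ℤ ≡ r - a
    simplify = solve-∀
    eq : slack r M (lookup ∅) (lookup ⁅ j ⁆) ≡ r - col j
    eq rewrite slack-net (lookup ∅) (lookup ⁅ j ⁆) | over-⁅⁆ j col | over-∅ row
             | size-⁅⁆ j | size-∅ {n} = simplify (col j) r

  Σrow≡Σcol : sum row ≡ sum col
  Σrow≡Σcol = ∑-comm (λ x y → 𝟙 (X x y))

  row≡r : ∀ i → row i ≡ r
  row≡r = sum-≤⇒≗ r≤row (subst (ℤ._≤ sum {n} (λ _ → r)) (sym Σrow≡Σcol) (sum-mono col≤r))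

  col≡r : ∀ j → col j ≡ r
  col≡r j = sym (sum-≤⇒≗ col≤r (subst (sum {n} (λ _ → r) ℤ.≤_) Σrow≡Σcol (sum-mono r≤row)) j)

IsFactor : ℤ → (A X : Fin n → Fin n → Bool) → Set
IsFactor r A X = (∀ x y → X x y ≡ true → A x y ≡ true)
  × (∀ x → sum (λ y → 𝟙 (X x y)) ≡ r) × (∀ y → sum (λ x → 𝟙 (X x y)) ≡ r)

bipartite-factor : ∀ {r k} (A : Fin n → Fin n → Bool) → 0ℤ ℤ.≤ r → r ℤ.≤ k →
  (∀ x → sum (λ y → 𝟙 (A x y)) ≡ k) → (∀ y → sum (λ x → 𝟙 (A x y)) ≡ k) → ∃[ X ] IsFactor r A X
bipartite-factor {n} {r} A 0≤r r≤k rows cols = extract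
  (decide-cells r (cartesianProduct (allFin n) (allFin n)) (candidates A)
    (candidates-feasible A 0≤r r≤k rows cols))
  where
  extract : ∃[ M ] Feasible r M × (∀ x y → candidates A x y ≢ free → M x y ≡ candidates A x y)
    × (∀ x y → (x , y) ∈ cartesianProduct (allFin n) (allFin n) → M x y ≢ free) → ∃[ X ] IsFactor r A X
  extract (M , feasible , keeps , decided) = X , (λ x y → inside (A x y) (M x y) (keeps x y)) , row≡r , col≡r
    where
    open Decided r M feasible (λ x y → decided x y (∈-cartesianProduct⁺ (∈-allFin x) (∈-allFin y)))
    candidate : Bool → Cell
    candidate a = if a then free else out
    inside : ∀ a c → (candidate a ≢ free → c ≡ candidate a) → isInn c ≡ true → a ≡ true
    inside true  _ _    _    = refl
    inside false c keep isIn = contradiction (trans (sym isIn) (cong isInn (keep λ ()))) λ ()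

-- Flows on Boolean matrices

record MatrixFlow (A : Fin n → Fin n → Bool) : Set where
  field
    ω         : Fin n → Fin n → ℤ
    ω-sym     : ∀ u v → ω u v ≡ ω v u
    ω-in      : ∀ u v → InL (ω u v)
    ω-support : ∀ u v → A u v ≡ false → ω u v ≡ 0ℤ
    ω-sum     : ∀ u → sum (ω u) ≡ 1ℤ

weight : Bool → Bool → Bool → ℤ
weight a x y = 𝟙 a - 𝟙 x - 𝟙 y

weight-comm : ∀ a x y → weight a x y ≡ weight a y x
weight-comm a x y = swap (𝟙 a) (𝟙 x) (𝟙 y)
  where
  swap : ∀ a x y → a - x - y ≡ a - y - x
  swap = solve-∀

weight-in : ∀ a x y → (x ≡ true → a ≡ true) → (y ≡ true → a ≡ true) → InL (weight a x y)
weight-in true  true  true  _ _ = inj₁ refl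
weight-in true  true  false _ _ = inj₂ (inj₁ refl)
weight-in true  false true  _ _ = inj₂ (inj₁ refl)
weight-in true  false false _ _ = inj₂ (inj₂ refl)
weight-in false true  _     p _ = contradiction (p refl) λ ()
weight-in false false true  _ q = contradiction (q refl) λ ()
weight-in false false false _ _ = inj₂ (inj₁ refl)

weight-support : ∀ a x y → (x ≡ true → a ≡ true) → (y ≡ true → a ≡ true) →
  a ≡ false → weight a x y ≡ 0ℤ
weight-support false true  _     p _ _ = contradiction (p refl) λ ()
weight-support false false true  _ q _ = contradiction (q refl) λ ()
weight-support false false false _ _ _ = refl

-- The form with a matrix in place of a connected graph serves the even case, where `A` is half of
-- an Euler tour and may be disconnected.
odd-regular-flow : ∀ r (A : Fin n → Fin n → Bool) → (∀ u v → A u v ≡ A v u) →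
  0ℤ ℤ.≤ r → (∀ u → sum (λ v → 𝟙 (A u v)) ≡ r + r + 1ℤ) → MatrixFlow A
odd-regular-flow {n} r A A-sym 0≤r regular = flow
  (bipartite-factor {r = r} {k = r + r + 1ℤ} A 0≤r r≤k regular
    (λ v → trans (sum-cong-≗ (λ u → cong 𝟙 (A-sym u v))) (regular v)))
  where
  r≤k : r ℤ.≤ r + r + 1ℤ
  r≤k = subst (ℤ._≤ r + r + 1ℤ) (trans (ℤ.+-identityʳ _) (ℤ.+-identityʳ r))
    (ℤ.+-mono-≤ (ℤ.+-monoʳ-≤ r 0≤r) (+≤+ (ℕ.z≤n {1})))
  flow : ∃[ X ] IsFactor r A X → MatrixFlow A
  flow (X , X⊆A , rows , cols) = record
    { ω = ω
    ; ω-sym = λ u v → trans (weight-comm (A u v) (X u v) (X v u))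
                            (cong (λ a → weight a (X v u) (X u v)) (A-sym u v))
    ; ω-in = λ u v → weight-in (A u v) (X u v) (X v u) (X⊆A u v) (Xᵀ⊆A u v)
    ; ω-support = λ u v → weight-support (A u v) (X u v) (X v u) (X⊆A u v) (Xᵀ⊆A u v)
    ; ω-sum = ω-sum
    }
    where
    open ≡-Reasoning
    ω : Fin n → Fin n → ℤ
    ω u v = weight (A u v) (X u v) (X v u)
    Xᵀ⊆A : ∀ u v → X v u ≡ true → A u v ≡ true
    Xᵀ⊆A u v t = trans (A-sym u v) (X⊆A v u t)
    simplify : ∀ r → r + r + 1ℤ - r - r ≡ 1ℤ
    simplify = solve-∀
    ω-sum : ∀ u → sum (ω u) ≡ 1ℤ
    ω-sum u = begin
      sum (λ v → 𝟙 (A u v) - 𝟙 (X u v) - 𝟙 (X v u))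
        ≡⟨ sum-sub (λ v → 𝟙 (A u v) - 𝟙 (X u v)) (λ v → 𝟙 (X v u)) ⟩
      sum (λ v → 𝟙 (A u v) - 𝟙 (X u v)) - sum (λ v → 𝟙 (X v u))
        ≡⟨ cong₂ _-_ (sum-sub (λ v → 𝟙 (A u v)) (λ v → 𝟙 (X u v))) (cols u) ⟩
      sum (λ v → 𝟙 (A u v)) - sum (λ v → 𝟙 (X u v)) - r
        ≡⟨ cong₂ (λ a b → a - b - r) (regular u) (rows u) ⟩
      r + r + 1ℤ - r - r ≡⟨ simplify r ⟩
      1ℤ ∎

-- Neighbour lists and adjacency matrices

sumℤ-++ : (xs ys : List ℤ) → sumℤ (xs ++ ys) ≡ sumℤ xs + sumℤ ys
sumℤ-++ []       ys = sym (ℤ.+-identityˡ (sumℤ ys))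
sumℤ-++ (x ∷ xs) ys = trans (cong (λ s → x + s) (sumℤ-++ xs ys)) (sym (ℤ.+-assoc x (sumℤ xs) (sumℤ ys)))

sumℤ-tabulate : {B : Set} (f : B → ℤ) (g : Fin n → B) → sumℤ (map f (tabulate g)) ≡ sum (f ∘ g)
sumℤ-tabulate {zero}  f g = refl
sumℤ-tabulate {suc n} f g = cong (λ s → f (g zero) + s) (sumℤ-tabulate f (g ∘ suc))

sumℤ-filter : {B : Set} {P : B → Set} (P? : Decidable P) (f : B → ℤ) (xs : List B) →
  sumℤ (map f (filter P? xs)) ≡ sumℤ (map (λ x → 𝟙 (does (P? x)) * f x) xs)
sumℤ-filter P? f [] = refl
sumℤ-filter P? f (x ∷ xs) with does (P? x)
... | true  = cong₂ _+_ (sym (ℤ.*-identityˡ (f x))) (sumℤ-filter P? f xs)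
... | false = trans (sumℤ-filter P? f xs)
  (trans (sym (ℤ.+-identityˡ rest)) (cong (λ z → z + rest) (sym (ℤ.*-zeroˡ (f x)))))
  where rest = sumℤ (map (λ x → 𝟙 (does (P? x)) * f x) xs)

sumℤ-cartesianProduct : {B C : Set} (f : B × C → ℤ) (xs : List B) (ys : List C) →
  sumℤ (map f (cartesianProduct xs ys)) ≡ sumℤ (map (λ x → sumℤ (map (λ y → f (x , y)) ys)) xs)
sumℤ-cartesianProduct f [] ys = refl
sumℤ-cartesianProduct f (x ∷ xs) ys = begin
  sumℤ (map f (map (x ,_) ys ++ cartesianProduct xs ys))
    ≡⟨ cong sumℤ (List.map-++ f (map (x ,_) ys) (cartesianProduct xs ys)) ⟩
  sumℤ (map f (map (x ,_) ys) ++ map f (cartesianProduct xs ys))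
    ≡⟨ sumℤ-++ (map f (map (x ,_) ys)) _ ⟩
  sumℤ (map f (map (x ,_) ys)) + sumℤ (map f (cartesianProduct xs ys))
    ≡⟨ cong₂ _+_ (cong sumℤ (sym (List.map-∘ ys))) (sumℤ-cartesianProduct f xs ys) ⟩
  sumℤ (map (λ y → f (x , y)) ys) + sumℤ (map (λ x → sumℤ (map (λ y → f (x , y)) ys)) xs) ∎
  where open ≡-Reasoning

sumℤ-ones : {B : Set} (xs : List B) → sumℤ (map (λ _ → 1ℤ) xs) ≡ + length xs
sumℤ-ones []       = refl
sumℤ-ones (x ∷ xs) = cong (λ s → 1ℤ + s) (sumℤ-ones xs)

adjacent : Graph n → Fin n → Fin n → Bool
adjacent G u v = does (adj? G u v)

sum-neighbours : (G : Graph n) (f : Fin n → ℤ) (v : Fin n) →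
  sumℤ (map f (neighbours G v)) ≡ sum (λ u → 𝟙 (adjacent G v u) * f u)
sum-neighbours G f v =
  trans (sumℤ-filter (adj? G v) f (allFin _)) (sumℤ-tabulate (λ u → 𝟙 (adjacent G v u) * f u) (λ u → u))

sum-adjacent : (G : Graph n) (v : Fin n) → sum (λ u → 𝟙 (adjacent G v u)) ≡ + degree G v
sum-adjacent G v = begin
  sum (λ u → 𝟙 (adjacent G v u))        ≡⟨ sum-cong-≗ (λ u → ℤ.*-identityʳ (𝟙 (adjacent G v u))) ⟨
  sum (λ u → 𝟙 (adjacent G v u) * 1ℤ)   ≡⟨ sum-neighbours G (λ _ → 1ℤ) v ⟨
  sumℤ (map (λ _ → 1ℤ) (neighbours G v)) ≡⟨ sumℤ-ones (neighbours G v) ⟩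
  + degree G v                          ∎
  where open ≡-Reasoning

does-⇔ : {P Q : Set} (P? : Dec P) (Q? : Dec Q) → (P → Q) → (Q → P) → does P? ≡ does Q?
does-⇔ (yes p) Q? P⇒Q Q⇒P = sym (dec-true Q? (P⇒Q p))
does-⇔ (no ¬p) Q? P⇒Q Q⇒P = sym (dec-false Q? (¬p ∘ Q⇒P))

adjacent-sym : (G : Graph n) (u v : Fin n) → adjacent G u v ≡ adjacent G v u
adjacent-sym G u v = does-⇔ (adj? G u v) (adj? G v u) (adj-sym G) (adj-sym G)

-- Edges of `G` outside `A` carry weight 0, so a flow on a spanning subgraph already is a flow on
-- `G`.
toOneSumFlow : (G : Graph n) (A : Fin n → Fin n → Bool) →
  (∀ u v → adjacent G u v ≡ false → A u v ≡ false) → MatrixFlow A → OneSumFlow G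
toOneSumFlow G A A⊆G flow = record
  { ω     = ω
  ; ω-sym = λ u v _ → ω-sym u v
  ; ω-in  = λ u v _ → ω-in u v
  ; sum-1 = λ v → trans (sum-neighbours G (ω v) v) (trans (sum-cong-≗ (mask v)) (ω-sum v))
  }
  where
  open MatrixFlow flow
  mask : ∀ v u → 𝟙 (adjacent G v u) * ω v u ≡ ω v u
  mask v u with adjacent G v u in eq
  ... | true  = ℤ.*-identityˡ (ω v u)
  ... | false = trans (ℤ.*-zeroˡ (ω v u)) (sym (ω-support v u (A⊆G v u eq)))

-- Trails

Arc : ℕ → Set
Arc n = Fin n × Fin n

-- Edge multisets are compared through such totals with symmetric `f`, which see neither the order
-- nor the orientation of arcs. The weights `joins u v`, `incidence v` and the constant 1 yield
-- multiplicity, degree and length.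
total : (Fin n → Fin n → ℤ) → List (Arc n) → ℤ
total f L = sumℤ (map (uncurry f) L)

Symmetric : (Fin n → Fin n → ℤ) → Set
Symmetric f = ∀ x y → f x y ≡ f y x

total-++ : (f : Fin n → Fin n → ℤ) (K L : List (Arc n)) → total f (K ++ L) ≡ total f K + total f L
total-++ f K L = trans (cong sumℤ (List.map-++ (uncurry f) K L)) (sumℤ-++ (map (uncurry f) K) (map (uncurry f) L))

total-cong : {f g : Fin n → Fin n → ℤ} → (∀ x y → f x y ≡ g x y) → ∀ L → total f L ≡ total g L
total-cong f≡g []            = refl
total-cong f≡g ((x , y) ∷ L) = cong₂ _+_ (f≡g x y) (total-cong f≡g L)

total-∑ : ∀ {m} (f : Fin m → Fin n → Fin n → ℤ) (L : List (Arc n)) →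
  total (λ x y → sum (λ w → f w x y)) L ≡ sum (λ w → total (f w) L)
total-∑ f [] = sym (sum-zero (λ w → total (f w) []) (λ _ → refl))
total-∑ f ((x , y) ∷ L) = trans (cong (λ s → sum (λ w → f w x y) + s) (total-∑ f L))
                                (sym (∑-distrib-+ (λ w → f w x y) (λ w → total (f w) L)))

total-nonneg : (f : Fin n → Fin n → ℤ) → (∀ x y → 0ℤ ℤ.≤ f x y) → ∀ L → 0ℤ ℤ.≤ total f L
total-nonneg f 0≤f []            = ℤ.≤-refl
total-nonneg f 0≤f ((x , y) ∷ L) = ℤ.+-mono-≤ (0≤f x y) (total-nonneg f 0≤f L)

joins : Fin n → Fin n → Fin n → Fin n → ℤ
joins u v x y = δ u x * δ v y + δ u y * δ v x

incidence : Fin n → Fin n → Fin n → ℤ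
incidence v x y = δ v x + δ v y

joins-symmetric : (u v : Fin n) → Symmetric (joins u v)
joins-symmetric u v x y = ℤ.+-comm (δ u x * δ v y) (δ u y * δ v x)

joins-swap : (u v x y : Fin n) → joins u v x y ≡ joins v u x y
joins-swap u v x y = swap (δ u x) (δ v y) (δ u y) (δ v x)
  where
  swap : ∀ a b c d → a * b + c * d ≡ d * c + b * a
  swap = solve-∀

incidence-symmetric : (v : Fin n) → Symmetric (incidence v)
incidence-symmetric v x y = ℤ.+-comm (δ v x) (δ v y)

joins-nonneg : (u v x y : Fin n) → 0ℤ ℤ.≤ joins u v x y
joins-nonneg u v x y = ℤ.+-mono-≤ (0≤δδ u x v y) (0≤δδ u y v x)

sum-δ₂ : (y : Fin n) → sum (λ w → δ w y) ≡ 1ℤ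
sum-δ₂ y = trans (sum-cong-≗ (λ w → δ-sym w y)) (sum-δ₁ y)

sum-joins : (v x y : Fin n) → sum (λ w → joins v w x y) ≡ incidence v x y
sum-joins v x y = begin
  sum (λ w → δ v x * δ w y + δ v y * δ w x)
    ≡⟨ ∑-distrib-+ (λ w → δ v x * δ w y) (λ w → δ v y * δ w x) ⟩
  sum (λ w → δ v x * δ w y) + sum (λ w → δ v y * δ w x)
    ≡⟨ cong₂ _+_ (*-distribˡ-sum (δ v x) (λ w → δ w y)) (*-distribˡ-sum (δ v y) (λ w → δ w x)) ⟨
  δ v x * sum (λ w → δ w y) + δ v y * sum (λ w → δ w x)
    ≡⟨ cong₂ (λ a b → δ v x * a + δ v y * b) (sum-δ₂ y) (sum-δ₂ x) ⟩
  δ v x * 1ℤ + δ v y * 1ℤ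
    ≡⟨ cong₂ _+_ (ℤ.*-identityʳ (δ v x)) (ℤ.*-identityʳ (δ v y)) ⟩
  δ v x + δ v y ∎
  where open ≡-Reasoning

total-incidence : (v : Fin n) (L : List (Arc n)) → total (incidence v) L ≡ sum (λ w → total (joins v w) L)
total-incidence v L = trans (total-cong (λ x y → sym (sum-joins v x y)) L) (total-∑ (λ w → joins v w) L)

handshake : (L : List (Arc n)) →
  sum (λ v → total (incidence v) L) ≡ total (λ _ _ → 1ℤ) L + total (λ _ _ → 1ℤ) L
handshake L = trans (sym (total-∑ incidence L)) (trans (total-cong two L) (double L))
  where
  two : ∀ x y → sum (λ v → incidence v x y) ≡ 1ℤ + 1ℤ
  two x y = trans (∑-distrib-+ (λ v → δ v x) (λ v → δ v y)) (cong₂ _+_ (sum-δ₂ x) (sum-δ₂ y))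
  regroup : ∀ a → 1ℤ + 1ℤ + (a + a) ≡ (1ℤ + a) + (1ℤ + a)
  regroup = solve-∀
  double : ∀ L → total (λ _ _ → 1ℤ + 1ℤ) L ≡ total (λ _ _ → 1ℤ) L + total (λ _ _ → 1ℤ) L
  double []      = refl
  double (_ ∷ L) = trans (cong (λ s → 1ℤ + 1ℤ + s) (double L)) (regroup (total (λ _ _ → 1ℤ) L))

-- Nothing in the type ties the arcs to a graph or forbids repetition; that is imposed afterwards by
-- comparing totals with the edge list.
data Trail {n} : Fin n → Fin n → Set where
  []  : ∀ {a} → Trail a a
  _∷_ : ∀ a {c b} → Trail c b → Trail a b

arcs : {a b : Fin n} → Trail a b → List (Arc n)
arcs []            = []
arcs (_∷_ a {c} T) = (a , c) ∷ arcs T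

_⋯_ : {a b c : Fin n} → Trail a b → Trail b c → Trail a c
[]      ⋯ U = U
(a ∷ T) ⋯ U = a ∷ (T ⋯ U)

arcs-⋯ : {a b c : Fin n} (T : Trail a b) (U : Trail b c) → arcs (T ⋯ U) ≡ arcs T ++ arcs U
arcs-⋯ []            U = refl
arcs-⋯ (_∷_ a {b} T) U = cong ((a , b) ∷_) (arcs-⋯ T U)

-- Each passage through `v` uses two arc ends. Only the two ends of the trail contribute single
-- ones, and the two added deltas pair them up.
trail-parity : ∀ (v : Fin n) {a b} (T : Trail a b) →
  ∃[ t ] total (incidence v) (arcs T) + δ v a + δ v b ≡ t + t
trail-parity v {a} [] = δ v a , cong (λ s → s + δ v a) (ℤ.+-identityˡ (δ v a))
trail-parity v {b = b} (_∷_ a {c} T) with trail-parity v T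
... | t , even = δ v a + t , trans (regroup (δ v a) (δ v c) (δ v b) (total (incidence v) (arcs T)))
                                   (trans (cong (λ s → δ v a + δ v a + s) even) (regroup′ (δ v a) t))
  where
  regroup : ∀ a c b s → a + c + s + a + b ≡ a + a + (s + c + b)
  regroup = solve-∀
  regroup′ : ∀ a t → a + a + (t + t) ≡ a + t + (a + t)
  regroup′ = solve-∀

-- A visit is recorded as a place to cut the trail, which is what rotating it requires.
Visits : {a b : Fin n} → Fin n → Trail a b → Set
Visits {a = a} {b} x T = ∃[ P ] ∃[ Q ] arcs {a = a} {x} P ++ arcs {a = x} {b} Q ≡ arcs T

visits-end : ∀ (u v : Fin n) {a b} (T : Trail a b) → total (joins u v) (arcs T) ≢ 0ℤ → Visits v T
visits-end u v []      ≢0 = contradiction refl ≢0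
visits-end u v (_∷_ a {c} T) ≢0 with v Fin.≟ a | v Fin.≟ c
... | yes refl | _        = [] , a ∷ T , refl
... | no _     | yes refl = a ∷ [] , T , refl
... | no v≢a   | no v≢c   =
  let P , Q , split = visits-end u v T
        (λ ≡0 → ≢0 (trans (cong (λ s → s + total (joins u v) (arcs T)) unused) (trans (ℤ.+-identityˡ _) ≡0)))
  in  a ∷ P , Q , cong ((a , c) ∷_) split
  where
  unused : joins u v a c ≡ 0ℤ
  unused = trans (cong₂ (λ s t → δ u a * s + δ u c * t) (δ-≢ v≢c) (δ-≢ v≢a))
                 (cong₂ _+_ (ℤ.*-zeroʳ (δ u a)) (ℤ.*-zeroʳ (δ u c)))

-- `R′` is `R` with one edge vw removed, up to orientation; its length is recorded as the measure
-- for the recursion.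
Incident : Fin n → List (Arc n) → Set
Incident v R = ∃[ w ] ∃[ R′ ] length R ≡ suc (length R′) × (∀ f → Symmetric f → f v w + total f R′ ≡ total f R)

-- The negative answer covers every weight concentrated at `v`, so that it applies both to `joins`,
-- for connectivity, and to `incidence`, for parity.
incident? : (v : Fin n) (R : List (Arc n)) →
  Incident v R ⊎ (∀ f → (∀ x y → v ≢ x → v ≢ y → f x y ≡ 0ℤ) → total f R ≡ 0ℤ)
incident? v [] = inj₂ (λ _ _ → refl)
incident? {n} v ((x , y) ∷ R) = search (v Fin.≟ x) (v Fin.≟ y)
  where
  Result = Incident v ((x , y) ∷ R)
    ⊎ (∀ f → (∀ x y → v ≢ x → v ≢ y → f x y ≡ 0ℤ) → total f ((x , y) ∷ R) ≡ 0ℤ)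
  swap : ∀ a b c → a + (b + c) ≡ b + (a + c)
  swap = solve-∀
  search : Dec (v ≡ x) → Dec (v ≡ y) → Result
  search (yes refl) _          = inj₁ (y , R , refl , λ _ _ → refl)
  search (no _)     (yes refl) = inj₁ (x , R , refl , λ f f-sym → cong (λ s → s + total f R) (f-sym y x))
  search (no v≢x)   (no v≢y) with incident? v R
  ... | inj₁ (w , R′ , len , split) = inj₁ (w , (x , y) ∷ R′ , cong suc len
    , λ f f-sym → trans (swap (f v w) (f x y) (total f R′)) (cong (λ s → f x y + s) (split f f-sym)))
  ... | inj₂ avoid = inj₂ (λ f f≡0 → cong₂ _+_ (f≡0 x y v≢x v≢y) (avoid f f≡0))

joins-avoid : (u v x y : Fin n) → u ≢ x → u ≢ y → joins u v x y ≡ 0ℤ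
joins-avoid u v x y u≢x u≢y = cong₂ (λ s t → s * δ v y + t * δ v x) (δ-≢ u≢x) (δ-≢ u≢y)

incidence-avoid : (v x y : Fin n) → v ≢ x → v ≢ y → incidence v x y ≡ 0ℤ
incidence-avoid v x y v≢x v≢y = cong₂ _+_ (δ-≢ v≢x) (δ-≢ v≢y)

odd≢even : ∀ i j → i + i + 1ℤ ≢ j + j
odd≢even i j eq = no-half (j - i) (trans (regroup i j) (trans (cong (λ s → s - (i + i)) (sym eq)) (cancel i)))
  where
  regroup : ∀ i j → (j - i) + (j - i) ≡ (j + j) - (i + i)
  regroup = solve-∀
  cancel : ∀ i → i + i + 1ℤ - (i + i) ≡ 1ℤ
  cancel = solve-∀
  no-half : ∀ d → d + d ≢ 1ℤ
  no-half (+ zero)  ()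
  no-half (+ suc m) eq = contradiction
    (trans (sym (ℕ.+-suc m m)) (ℕ.suc-injective (ℤ.+-injective eq))) λ ()
  no-half -[1+ m ]  ()

-- Hierholzer's construction of an Euler tour

module Euler {n} (G : Graph n) (connected : Connected G) (E : List (Arc n))
  (covers : ∀ u v → Adj G u v → total (joins u v) E ≡ 1ℤ)
  (even : ∀ v → ∃[ j ] total (incidence v) E ≡ j + j) where

  Splits : List (Arc n) → List (Arc n) → Set
  Splits L R = ∀ f → Symmetric f → total f L + total f R ≡ total f E

  reach : ∀ {a b} (T : Trail a b) R → Splits (arcs T) R → ∀ {u p} → Walk G u p → Visits u T →
    (∃[ x ] Visits x T × Incident x R) ⊎ Visits p T
  reach T R splits here visits = inj₂ visits
  reach T R splits (step {u} {w} uw walk) visits = follow (total (joins u w) (arcs T) ℤ.≟ 0ℤ) (incident? u R)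
    where
    follow : Dec (total (joins u w) (arcs T) ≡ 0ℤ) → _ → _
    follow (no ≢0)  _               = reach T R splits walk (visits-end u w T ≢0)
    follow (yes _)  (inj₁ incident) = inj₁ (u , visits , incident)
    follow (yes ≡0) (inj₂ avoid)    = contradiction
      (trans (sym (covers u w uw)) (trans (sym (splits (joins u w) (joins-symmetric u w)))
        (cong₂ _+_ ≡0 (avoid (joins u w) (joins-avoid u w))))) λ ()

  stuck-closed : ∀ {a b} (T : Trail a b) R → Splits (arcs T) R →
    (∀ f → (∀ x y → a ≢ x → a ≢ y → f x y ≡ 0ℤ) → total f R ≡ 0ℤ) → a ≡ b
  stuck-closed {a} {b} T R splits avoid with a Fin.≟ b | even a | trail-parity a T
  ... | yes a≡b | _      | _      = a≡b
  ... | no a≢b  | j , ej | t , et = contradiction eq (odd≢even j t)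
    where
    d = total (incidence a) (arcs T)
    d≡j+j : d ≡ j + j
    d≡j+j = trans (sym (ℤ.+-identityʳ d))
      (trans (cong (λ s → d + s) (sym (avoid (incidence a) (incidence-avoid a))))
        (trans (splits (incidence a) (incidence-symmetric a)) ej))
    eq : j + j + 1ℤ ≡ t + t
    eq = trans (sym (ℤ.+-identityʳ (j + j + 1ℤ)))
      (trans (cong₂ (λ s z → s + 1ℤ + z) (sym d≡j+j) (sym (δ-≢ a≢b)))
        (trans (cong (λ o → d + o + δ a b) (sym (δ-refl a))) et))

  rotate : ∀ {a x} (T : Trail a a) → Visits x T →
    ∃[ T′ ] (∀ (f : Fin n → Fin n → ℤ) → total f (arcs {a = x} {x} T′) ≡ total f (arcs T))
  rotate T (P , Q , split) = Q ⋯ P , λ f → begin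
    total f (arcs (Q ⋯ P))                ≡⟨ cong (total f) (arcs-⋯ Q P) ⟩
    total f (arcs Q ++ arcs P)            ≡⟨ total-++ f (arcs Q) (arcs P) ⟩
    total f (arcs Q) + total f (arcs P)   ≡⟨ ℤ.+-comm (total f (arcs Q)) (total f (arcs P)) ⟩
    total f (arcs P) + total f (arcs Q)   ≡⟨ total-++ f (arcs P) (arcs Q) ⟨
    total f (arcs P ++ arcs Q)            ≡⟨ cong (total f) split ⟩
    total f (arcs T)                      ∎
    where open ≡-Reasoning

  -- T traverses each edge of E once: symmetric weights see arcs up to order and
  -- orientation.
  EulerTour : Set
  EulerTour = ∃[ c ] ∃[ T ] (∀ f → Symmetric f → total f (arcs {a = c} {c} T) ≡ total f E)

  splits-extend : ∀ {a b w} (T : Trail a b) R R′ →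
    (∀ f → Symmetric f → f a w + total f R′ ≡ total f R) → Splits (arcs T) R → Splits (arcs (w ∷ T)) R′
  splits-extend {a} {w = w} T R R′ split splits f f-sym = begin
    f w a + total f (arcs T) + total f R′   ≡⟨ regroup (f w a) (total f (arcs T)) (total f R′) ⟩
    total f (arcs T) + (f w a + total f R′)
      ≡⟨ cong (λ s → total f (arcs T) + (s + total f R′)) (f-sym w a) ⟩
    total f (arcs T) + (f a w + total f R′) ≡⟨ cong (λ s → total f (arcs T) + s) (split f f-sym) ⟩
    total f (arcs T) + total f R            ≡⟨ splits f f-sym ⟩
    total f E                               ∎
    where
    open ≡-Reasoning
    regroup : ∀ a t r → a + t + r ≡ t + (a + r)
    regroup = solve-∀

  extend : ∀ m {a b} (T : Trail a b) R → length R ≡ m → Splits (arcs T) R → EulerTour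
  extend-along : ∀ m {a b} (T : Trail a b) R → length R ≡ m → Splits (arcs T) R → Incident a R → EulerTour
  extend-closed : ∀ m {a} (T : Trail a a) R → length R ≡ m → Splits (arcs T) R → EulerTour

  extend-along zero    T R len splits (w , R′ , len′ , split) = contradiction (trans (sym len) len′) λ ()
  extend-along (suc m) T R len splits (w , R′ , len′ , split) = extend m (w ∷ T) R′
    (ℕ.suc-injective (trans (sym len′) len)) (splits-extend T R R′ split splits)

  extend m {a} T R len splits with incident? a R
  ... | inj₁ incident = extend-along m T R len splits incident
  ... | inj₂ avoid with stuck-closed T R splits avoid
  ...   | refl = extend-closed m T R len splits

  extend-closed m {a} T [] len splits =
    a , T , λ f f-sym → trans (sym (ℤ.+-identityʳ (total f (arcs T)))) (splits f f-sym)
  extend-closed m {a} T ((p , q) ∷ R) len splits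
    with reach T ((p , q) ∷ R) splits (connected a p) ([] , T , refl)
  ... | inj₁ (x , visits , incident) with rotate T visits
  ...   | T′ , same = extend-along m T′ ((p , q) ∷ R) len
            (λ f f-sym → trans (cong (λ s → s + total f ((p , q) ∷ R)) (same f)) (splits f f-sym)) incident
  extend-closed m {a} T ((p , q) ∷ R) len splits
      | inj₂ visits with rotate T visits
  ...   | T′ , same = extend-along m T′ ((p , q) ∷ R) len
            (λ f f-sym → trans (cong (λ s → s + total f ((p , q) ∷ R)) (same f)) (splits f f-sym))
            (q , R , refl , λ _ _ → refl)

  eulerTour : Fin n → EulerTour
  eulerTour a = extend (length E) {a} [] E refl (λ f _ → ℤ.+-identityˡ (total f E))


-- Balanced splitting along an Euler tour

odds evens : {B : Set} → List B → List B
odds []        = []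
odds (x ∷ xs)  = x ∷ evens xs
evens []       = []
evens (x ∷ xs) = odds xs

total-odds+evens : (f : Fin n → Fin n → ℤ) (L : List (Arc n)) → total f (odds L) + total f (evens L) ≡ total f L
total-odds+evens f []            = refl
total-odds+evens f ((x , y) ∷ L) = trans (regroup (f x y) (total f (evens L)) (total f (odds L)))
                                         (cong (λ s → f x y + s) (total-odds+evens f L))
  where
  regroup : ∀ a e o → a + e + o ≡ a + (o + e)
  regroup = solve-∀

-- This is -1 to the power of the number of arcs.
sign : {a b : Fin n} → Trail a b → ℤ
sign []      = 1ℤ
sign (a ∷ T) = - sign T

arcCount : List (Arc n) → ℤ
arcCount = total (λ _ _ → 1ℤ)

-- The sign is kept in the even case only, because the odd case will be refuted by the edge count.
sign-parity : {a b : Fin n} (T : Trail a b) →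
  (sign T ≡ 1ℤ × ∃[ t ] arcCount (arcs T) ≡ t + t) ⊎ (∃[ t ] arcCount (arcs T) ≡ t + t + 1ℤ)
sign-parity T = weaken (go T)
  where
  Parity : {a b : Fin _} → Trail a b → Set
  Parity T = (sign T ≡ 1ℤ × ∃[ t ] arcCount (arcs T) ≡ t + t)
           ⊎ (sign T ≡ - 1ℤ × ∃[ t ] arcCount (arcs T) ≡ t + t + 1ℤ)
  swap : ∀ t → 1ℤ + (t + t) ≡ t + t + 1ℤ
  swap = solve-∀
  carry : ∀ t → 1ℤ + (t + t + 1ℤ) ≡ (t + 1ℤ) + (t + 1ℤ)
  carry = solve-∀
  go : {a b : Fin _} (T : Trail a b) → Parity T
  go [] = inj₁ (refl , 0ℤ , refl)
  go (a ∷ T) with go T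
  ... | inj₁ (s , t , e) = inj₂ (cong -_ s , t , trans (cong (λ z → 1ℤ + z) e) (swap t))
  ... | inj₂ (s , t , e) = inj₁ (cong -_ s , t + 1ℤ , trans (cong (λ z → 1ℤ + z) e) (carry t))
  weaken : Parity T → _
  weaken (inj₁ p)       = inj₁ p
  weaken (inj₂ (_ , p)) = inj₂ p

-- Consecutive arcs share a vertex and have opposite signs, so inner visits cancel and only the two
-- ends survive. On a closed trail of even length these cancel as well.
telescope : ∀ (v : Fin n) {a b} (T : Trail a b) →
  total (incidence v) (odds (arcs T)) - total (incidence v) (evens (arcs T)) ≡ δ v a - sign T * δ v b
telescope v {a} [] = sym (cancel (δ v a))
  where
  cancel : ∀ d → d - 1ℤ * d ≡ 0ℤ
  cancel = solve-∀
telescope v {b = b} (_∷_ a {c} T) = begin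
  δ v a + δ v c + e - o                      ≡⟨ regroup (δ v a) (δ v c) e o ⟩
  δ v a + δ v c - (o - e)                    ≡⟨ cong (λ z → δ v a + δ v c - z) (telescope v T) ⟩
  δ v a + δ v c - (δ v c - sign T * δ v b)   ≡⟨ regroup′ (δ v a) (δ v c) (sign T) (δ v b) ⟩
  δ v a - (- sign T) * δ v b                 ∎
  where
  open ≡-Reasoning
  o = total (incidence v) (odds (arcs T))
  e = total (incidence v) (evens (arcs T))
  regroup : ∀ a c e o → a + c + e - o ≡ a + c - (o - e)
  regroup = solve-∀
  regroup′ : ∀ a c s b → a + c - (c - s * b) ≡ a - (- s) * b
  regroup′ = solve-∀

double-injective : ∀ i j → i + i ≡ j + j → i ≡ j
double-injective i j eq = ℤ.*-cancelˡ-≡ (+ 2) i j (trans (twice i) (trans eq (sym (twice j))))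
  where
  twice : ∀ i → + 2 * i ≡ i + i
  twice = solve-∀

-- The edge list of a graph, each edge oriented from its smaller end

oriented? : (G : Graph n) → Decidable {A = Arc n} (λ (x , y) → x Fin.< y × Adj G x y)
oriented? G (x , y) = x Fin.<? y ×-dec adj? G x y

edges : Graph n → List (Arc n)
edges {n} G = filter (oriented? G) (cartesianProduct (allFin n) (allFin n))

oriented : Graph n → Fin n → Fin n → ℤ
oriented G x y = 𝟙 (does (oriented? G (x , y)))

total-edges : (G : Graph n) (f : Fin n → Fin n → ℤ) → total f (edges G) ≡ ∑∑ (λ x y → oriented G x y * f x y)
total-edges {n} G f = begin
  total f (edges G)
    ≡⟨ sumℤ-filter (oriented? G) (uncurry f) (cartesianProduct (allFin n) (allFin n)) ⟩
  sumℤ (map weighted (cartesianProduct (allFin n) (allFin n)))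
    ≡⟨ sumℤ-cartesianProduct weighted (allFin n) (allFin n) ⟩
  sumℤ (map (λ x → sumℤ (map (λ y → weighted (x , y)) (allFin n))) (allFin n))
    ≡⟨ sumℤ-tabulate (λ x → sumℤ (map (λ y → weighted (x , y)) (allFin n))) (λ x → x) ⟩
  sum (λ x → sumℤ (map (λ y → weighted (x , y)) (allFin n)))
    ≡⟨ sum-cong-≗ (λ x → sumℤ-tabulate (λ y → weighted (x , y)) (λ y → y)) ⟩
  ∑∑ (λ x y → oriented G x y * f x y) ∎
  where
  open ≡-Reasoning
  weighted : Arc n → ℤ
  weighted a = 𝟙 (does (oriented? G a)) * uncurry f a

oriented-either : (G : Graph n) (u v : Fin n) → oriented G u v + oriented G v u ≡ 𝟙 (adjacent G u v)
oriented-either G u v with Fin.<-cmp u v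
... | tri< u<v _ v≮u rewrite dec-true (u Fin.<? v) u<v | dec-false (v Fin.<? u) v≮u =
  ℤ.+-identityʳ (𝟙 (adjacent G u v))
... | tri≈ u≮u refl _ rewrite dec-false (u Fin.<? u) u≮u | dec-false (adj? G u u) (irrefl G) = refl
... | tri> u≮v _ v<u rewrite dec-false (u Fin.<? v) u≮v | dec-true (v Fin.<? u) v<u =
  trans (ℤ.+-identityˡ (𝟙 (adjacent G v u))) (cong 𝟙 (adjacent-sym G v u))

edges-join : (G : Graph n) (u v : Fin n) → total (joins u v) (edges G) ≡ 𝟙 (adjacent G u v)
edges-join G u v = begin
  total (joins u v) (edges G)                     ≡⟨ total-edges G (joins u v) ⟩
  ∑∑ (λ x y → e x y * (δ u x * δ v y + δ u y * δ v x))
    ≡⟨ ∑∑-cong (λ x y → expand (e x y) (δ u x) (δ v y) (δ u y) (δ v x)) ⟩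
  ∑∑ (λ x y → δ u x * δ v y * e x y + δ v x * δ u y * e x y)
    ≡⟨ ∑∑-+ (λ x y → δ u x * δ v y * e x y) (λ x y → δ v x * δ u y * e x y) ⟩
  ∑∑ (λ x y → δ u x * δ v y * e x y) + ∑∑ (λ x y → δ v x * δ u y * e x y)
    ≡⟨ cong₂ _+_ (∑∑-δ u v e) (∑∑-δ v u e) ⟩
  e u v + e v u                                   ≡⟨ oriented-either G u v ⟩
  𝟙 (adjacent G u v)                              ∎
  where
  open ≡-Reasoning
  e = oriented G
  expand : ∀ e a b c d → e * (a * b + c * d) ≡ a * b * e + d * c * e
  expand = solve-∀

edges-incidence : (G : Graph n) (v : Fin n) → total (incidence v) (edges G) ≡ + degree G v
edges-incidence G v = trans (total-incidence v (edges G))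
  (trans (sum-cong-≗ (edges-join G v)) (sum-adjacent G v))

-- Halving the degree of an even regular graph

HalfFactor : Graph n → ℤ → Set
HalfFactor {n} G j = ∃ λ (B : Fin n → Fin n → Bool) →
    (∀ u v → B u v ≡ B v u) × (∀ u v → adjacent G u v ≡ false → B u v ≡ false)
  × (∀ u → sum (λ v → 𝟙 (B u v)) ≡ j)

isOne : ℤ → Bool
isOne i = does (i ℤ.≟ 1ℤ)

𝟙-isOne : ∀ a i → 0ℤ ℤ.≤ i → i ℤ.≤ 𝟙 a → 𝟙 (isOne i) ≡ i
𝟙-isOne true  (+ 0)           _ _ = refl
𝟙-isOne true  (+ 1)           _ _ = refl
𝟙-isOne true  (+ suc (suc _)) _ (+≤+ (ℕ.s≤s ()))
𝟙-isOne false (+ 0)           _ _ = refl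
𝟙-isOne false (+ suc _)       _ (+≤+ ())

isOne-false : ∀ a i → 0ℤ ℤ.≤ i → i ℤ.≤ 𝟙 a → a ≡ false → isOne i ≡ false
isOne-false false (+ 0)     _ _        _ = refl
isOne-false false (+ suc _) _ (+≤+ ()) _

-- At each vertex the arcs in odd and in even positions of the tour number 2j together, and by
-- `telescope` equally many, provided that the length nj is even.
half-factor : (G : Graph (suc n)) → Connected G → ∀ j → (∀ v → + degree G v ≡ j + j) →
  (∃[ t ] + suc n * j ≡ t + t) → HalfFactor G j
half-factor {n} G connected j regular (t , nj≡t+t) = fromTour (eulerTour zero)
  where
  E = edges G
  covers : ∀ u v → Adj G u v → total (joins u v) E ≡ 1ℤ
  covers u v uv = trans (edges-join G u v) (cong 𝟙 (dec-true (adj? G u v) uv))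
  degree-even : ∀ v → total (incidence v) E ≡ j + j
  degree-even v = trans (edges-incidence G v) (regular v)
  open Euler G connected E covers (λ v → j , degree-even v)
  size-E : arcCount E ≡ t + t
  size-E = trans (double-injective (arcCount E) (+ suc n * j) (begin
    arcCount E + arcCount E                       ≡⟨ handshake E ⟨
    sum (λ v → total (incidence v) E)       ≡⟨ sum-cong-≗ degree-even ⟩
    sum {suc n} (λ _ → j + j)               ≡⟨ sum-const (suc n) (j + j) ⟩
    + suc n * (j + j)                       ≡⟨ ℤ.*-distribˡ-+ (+ suc n) j j ⟩
    + suc n * j + + suc n * j               ∎)) nj≡t+t
    where open ≡-Reasoning
  fromTour : EulerTour → HalfFactor G j
  fromTour (c , T , exhausts) = B , B-sym , B-support , B-regular
    where
    open ≡-Reasoning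
    L = arcs T
    -- This multiplicity is at most the one in the whole tour, hence 0 or 1, so comparing it with 1
    -- loses nothing.
    H : Fin (suc n) → Fin (suc n) → ℤ
    H u v = total (joins u v) (odds L)
    B : Fin (suc n) → Fin (suc n) → Bool
    B u v = isOne (H u v)
    0≤H : ∀ u v → 0ℤ ℤ.≤ H u v
    0≤H u v = total-nonneg (joins u v) (joins-nonneg u v) (odds L)
    H≤adjacent : ∀ u v → H u v ℤ.≤ 𝟙 (adjacent G u v)
    H≤adjacent u v = ℤ.≤-trans
      (subst (ℤ._≤ H u v + total (joins u v) (evens L)) (ℤ.+-identityʳ (H u v))
        (ℤ.+-monoʳ-≤ (H u v) (total-nonneg (joins u v) (joins-nonneg u v) (evens L))))
      (ℤ.≤-reflexive (trans (total-odds+evens (joins u v) L)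
        (trans (exhausts (joins u v) (joins-symmetric u v)) (edges-join G u v))))
    B-sym : ∀ u v → B u v ≡ B v u
    B-sym u v = cong isOne (total-cong (joins-swap u v) (odds L))
    B-support : ∀ u v → adjacent G u v ≡ false → B u v ≡ false
    B-support u v = isOne-false (adjacent G u v) (H u v) (0≤H u v) (H≤adjacent u v)
    sign≡1 : sign T ≡ 1ℤ
    sign≡1 with sign-parity T
    ... | inj₁ (s , _)   = s
    ... | inj₂ (t′ , sz) = contradiction
      (trans (sym sz) (trans (exhausts (λ _ _ → 1ℤ) (λ _ _ → refl)) size-E)) (odd≢even t′ t)
    balanced : ∀ u → total (incidence u) (odds L) ≡ j
    balanced u = double-injective o j (begin
      o + o               ≡⟨ regroup o e ⟩
      (o + e) + (o - e)   ≡⟨ cong₂ _+_ o+e o-e ⟩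
      j + j + 0ℤ          ≡⟨ ℤ.+-identityʳ (j + j) ⟩
      j + j               ∎)
      where
      o = total (incidence u) (odds L)
      e = total (incidence u) (evens L)
      regroup : ∀ o e → o + o ≡ (o + e) + (o - e)
      regroup = solve-∀
      cancel : ∀ d → d - 1ℤ * d ≡ 0ℤ
      cancel = solve-∀
      o+e : o + e ≡ j + j
      o+e = trans (total-odds+evens (incidence u) L)
        (trans (exhausts (incidence u) (incidence-symmetric u)) (degree-even u))
      o-e : o - e ≡ 0ℤ
      o-e = trans (telescope u T) (trans (cong (λ s → δ u c - s * δ u c) sign≡1) (cancel (δ u c)))
    B-regular : ∀ u → sum (λ v → 𝟙 (B u v)) ≡ j
    B-regular u = begin
      sum (λ v → 𝟙 (B u v))
        ≡⟨ sum-cong-≗ (λ v → 𝟙-isOne (adjacent G u v) (H u v) (0≤H u v) (H≤adjacent u v)) ⟩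
      sum (H u)                           ≡⟨ total-incidence u (odds L) ⟨
      total (incidence u) (odds L)        ≡⟨ balanced u ⟩
      j                                   ∎

theorem7 : (k n : ℕ) → 1 ≤ k → (G : Graph n) → Connected G → Regular k G →
    ((k % 2 ≡ 1 → OneSumFlow G) × (k % 4 ≡ 2 → n % 2 ≡ 0 → OneSumFlow G))
theorem7 k n _ G connected regular = odd , even n G connected regular
  where
  odd : k % 2 ≡ 1 → OneSumFlow G
  odd k%2≡1 = toOneSumFlow G (adjacent G) (λ _ _ eq → eq)
    (odd-regular-flow q (adjacent G) (adjacent-sym G) (+≤+ ℕ.z≤n) (λ u →
      trans (sum-adjacent G u) (cong +_ (trans (regular u) k≡))))
    where
    q = + (k ℕ./ 2)
    swap : ∀ q → 1 ℕ.+ q ℕ.* 2 ≡ q ℕ.+ q ℕ.+ 1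
    swap = ℕ-solve-∀
    k≡ : k ≡ k ℕ./ 2 ℕ.+ k ℕ./ 2 ℕ.+ 1
    k≡ = trans (ℕ.m≡m%n+[m/n]*n k 2) (trans (cong (λ m → m ℕ.+ k ℕ./ 2 ℕ.* 2) k%2≡1) (swap (k ℕ./ 2)))
  even : ∀ n (G : Graph n) → Connected G → Regular k G → k % 4 ≡ 2 → n % 2 ≡ 0 → OneSumFlow G
  -- The empty graph offers no base vertex for a tour.
  even zero G _ _ _ _ = record
    { ω = λ () ; ω-sym = λ () ; ω-in = λ () ; sum-1 = λ () }
  even (suc n) G connected regular k%4≡2 n%2≡0 = fromHalf
    (half-factor G connected j
      (λ v → cong +_ (trans (regular v) k≡))
      -- As `p` is half the order, nj = pj + pj, which makes the tour even.
      (p * j , trans (cong (λ m → + m * j) n≡) (ℤ.*-distribʳ-+ j p p)))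
    where
    -- From k = 4q + 2, the half degree is j = 2q + 1, and the odd case applies with r = q.
    q = k ℕ./ 4
    j = + (q ℕ.+ q ℕ.+ 1)
    p = + (suc n ℕ./ 2)
    quadruple : ∀ q → 2 ℕ.+ q ℕ.* 4 ≡ q ℕ.+ q ℕ.+ 1 ℕ.+ (q ℕ.+ q ℕ.+ 1)
    quadruple = ℕ-solve-∀
    double : ∀ p → p ℕ.* 2 ≡ p ℕ.+ p
    double = ℕ-solve-∀
    k≡ : k ≡ q ℕ.+ q ℕ.+ 1 ℕ.+ (q ℕ.+ q ℕ.+ 1)
    k≡ = trans (ℕ.m≡m%n+[m/n]*n k 4) (trans (cong (λ m → m ℕ.+ q ℕ.* 4) k%4≡2) (quadruple q))
    n≡ : suc n ≡ suc n ℕ./ 2 ℕ.+ suc n ℕ./ 2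
    n≡ = trans (ℕ.m≡m%n+[m/n]*n (suc n) 2)
      (trans (cong (λ m → m ℕ.+ suc n ℕ./ 2 ℕ.* 2) n%2≡0) (double (suc n ℕ./ 2)))
    fromHalf : HalfFactor G j → OneSumFlow G
    fromHalf (B , B-sym , B-support , B-regular) =
      toOneSumFlow G B B-support (odd-regular-flow (+ q) B B-sym (+≤+ ℕ.z≤n) B-regular)
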